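{- Let $r\geqslant 3$ and let $s\geqslant t\geqslant 2$ be integers. Then $$\mathrm{ex}_{r}(n,K_{s,t}^{(r)})=O\left(n^{r-\frac{1}{t}}\right)$$ as $n\to\infty$.
   Context: An $r$-graph is an $r$-uniform hypergraph. For an $r$-graph $\mathcal{H}$, $\mathrm{ex}_{r}(n,\mathcal{H})$ is the maximum number of edges in an $n$-vertex $r$-graph containing no copy of $\mathcal{H}$ as a (not necessarily induced) subhypergraph. The complete bipartite $r$-graph $K_{s,t}^{(r)}$ is defined as follows: let $X_{1},\ldots,X_{t}$ be $t$ pairwise disjoint sets of size $r-1$, and let $Y$ be a set of $s$ elements disjoint from $\bigcup_{i=1}^{t}X_{i}$. Then $K_{s,t}^{(r)}$ has vertex set $\left(\bigcup_{i=1}^{t}X_{i}\right)\cup Y$ and edge set $\{X_{i}\cup\{y\}: 1\leqslant i\leqslant t,\ y\in Y\}$. (For $r\geqslant 3$ and $s\neq t$, $K_{s,t}^{(r)}$ and $K_{t,s}^{(r)}$ are not isomorphic.) Asymptotic notation is for $n\to\infty$ with $r,s,t$ fixed; the implied constant does not depend on $n$. -}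

module Defs where

open import Data.Nat using (ℕ; zero; suc; _+_; _*_; _∸_; _^_; _≤_; s≤s)
import Data.Nat.Properties as ℕ
import Data.Bool.Properties as Bool
open import Data.Fin using (Fin; zero; suc; combine; _↑ˡ_; _↑ʳ_; splitAt; finToFun; funToFin)
import Data.Fin.Properties as Fin
open import Data.Fin.Subset using (Subset; inside; outside; ⊤; ⁅_⁆; _∪_; ∣_∣)
  renaming (_∈_ to _∈ˢ_; _∉_ to _∉ˢ_)
import Data.Fin.Subset.Properties as Subset
open import Data.List using (List; []; _∷_; _++_; map; filter; length; lookup; mapMaybe;
  allFin; cartesianProductWith)
open import Data.List.Extrema.Nat using (max; xs≤max; argmax-sel)
open import Data.List.Membership.Propositional using (_∈_; find; lose)
open import Data.List.Membership.Propositional.Properties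
  using (∈-map⁺; ∈-map⁻; ∈-++⁺ˡ; ∈-++⁺ʳ; ∈-filter⁺; ∈-filter⁻; ∈-lookup;
         ∈-cartesianProductWith⁻)
open import Data.List.Relation.Unary.All as All using (All; []; _∷_)
open import Data.List.Relation.Unary.Any as Any using (here; there; index)
import Data.List.Relation.Unary.Any.Properties as Any
open import Data.List.Relation.Unary.AllPairs using ([]; _∷_)
open import Data.List.Relation.Unary.Unique.Propositional using (Unique)
import Data.List.Relation.Unary.Unique.Propositional.Properties as Unique
import Data.List.Relation.Unary.Unique.DecPropositional as UniqueDec
import Data.List.Membership.DecPropositional as MembershipDec
open import Data.Maybe using (Maybe; just; nothing)
import Data.Maybe.Relation.Unary.Any as Maybe
open import Data.Product using (∃-syntax; _×_; _,_; proj₁; proj₂)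
open import Data.Sum using (inj₁; inj₂)
open import Data.Vec as Vec using ([]; _∷_; tabulate)
open import Data.Vec.Properties using (≡-dec; lookup∘tabulate; lookup⇒[]=; []=⇒lookup)
open import Function using (_∘_; id)
open import Function.Definitions using (Injective)
open import Relation.Binary using (DecidableEquality)
open import Relation.Binary.PropositionalEquality
open import Relation.Nullary using (¬_; Dec; yes; no; ¬?; _×-dec_; _→-dec_; does; contradiction)
open import Relation.Nullary.Decidable using (dec-true; map′)

private variable
  k m n r : ℕ

_≟ˢ_ : DecidableEquality (Subset n)
_≟ˢ_ = ≡-dec Bool._≟_

open module ∈-Dec {n} = MembershipDec (_≟ˢ_ {n}) using (_∈?_)
open module Unique-Dec {n} = UniqueDec (_≟ˢ_ {n}) using (unique?)

image : (Fin m → Fin n) → Subset m → Subset n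
image f p = tabulate λ j → does (Fin.any? λ i → (i Subset.∈? p) ×-dec (f i Fin.≟ j))

∈-image⁺ : ∀ (f : Fin m → Fin n) {p i} → i ∈ˢ p → f i ∈ˢ image f p
∈-image⁺ f {p} {i} i∈p = lookup⇒[]= (f i) _
  (trans (lookup∘tabulate _ (f i)) (dec-true (Fin.any? λ i′ → (i′ Subset.∈? p) ×-dec (f i′ Fin.≟ f i)) (i , i∈p , refl)))

∈-image⁻ : ∀ (f : Fin m → Fin n) p {j} → j ∈ˢ image f p → ∃[ i ] i ∈ˢ p × f i ≡ j
∈-image⁻ f p {j} j∈ with Fin.any? (λ i → (i Subset.∈? p) ×-dec (f i Fin.≟ j))
                         | trans (sym (lookup∘tabulate (λ j → does (Fin.any? λ i → (i Subset.∈? p) ×-dec (f i Fin.≟ j))) j))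
                                 ([]=⇒lookup j∈)
... | yes w | _ = w
... | no  _ | ()

image-cong : ∀ {f g : Fin m → Fin n} → f ≗ g → ∀ p → image f p ≡ image g p
image-cong {f = f} {g} f≗g p = Subset.⊆-antisym (half f g f≗g) (half g f (sym ∘ f≗g))
  where
  half : ∀ (f g : Fin _ → Fin _) → f ≗ g → ∀ {x} → x ∈ˢ image f p → x ∈ˢ image g p
  half f g f≗g x∈ with i , i∈p , refl ← ∈-image⁻ f p x∈ =
    subst (_∈ˢ image g p) (sym (f≗g i)) (∈-image⁺ g i∈p)

∣p∪⁅x⁆∣ : ∀ (p : Subset n) x → x ∉ˢ p → ∣ p ∪ ⁅ x ⁆ ∣ ≡ suc ∣ p ∣
∣p∪⁅x⁆∣ (inside  ∷ p) zero x∉p = contradiction (lookup⇒[]= zero _ refl) x∉p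
∣p∪⁅x⁆∣ (outside ∷ p) zero x∉p = cong (suc ∘ ∣_∣) (Subset.∪-identityʳ p)
∣p∪⁅x⁆∣ (inside  ∷ p) (suc x) x∉p = cong suc (∣p∪⁅x⁆∣ p x (x∉p ∘ Vec.there))
∣p∪⁅x⁆∣ (outside ∷ p) (suc x) x∉p = ∣p∪⁅x⁆∣ p x (x∉p ∘ Vec.there)

∣image∣ : ∀ (f : Fin m → Fin n) → Injective _≡_ _≡_ f → ∀ p → ∣ image f p ∣ ≡ ∣ p ∣
∣image∣ {n = n} f inj [] =
  trans (cong ∣_∣ (Subset.Empty-unique (λ (_ , x∈) → Fin.¬Fin0 (proj₁ (∈-image⁻ f [] x∈)))))
        (Subset.∣⊥∣≡0 n)
∣image∣ f inj (outside ∷ p) =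
  trans (cong ∣_∣ (Subset.⊆-antisym to from)) (∣image∣ (f ∘ suc) (Fin.suc-injective ∘ inj) p)
  where
  to : ∀ {x} → x ∈ˢ image f (outside ∷ p) → x ∈ˢ image (f ∘ suc) p
  to x∈ with ∈-image⁻ f (outside ∷ p) x∈
  ... | suc i , Vec.there i∈p , refl = ∈-image⁺ (f ∘ suc) i∈p
  from : ∀ {x} → x ∈ˢ image (f ∘ suc) p → x ∈ˢ image f (outside ∷ p)
  from x∈ with i , i∈p , refl ← ∈-image⁻ (f ∘ suc) p x∈ = ∈-image⁺ f {outside ∷ p} (Vec.there i∈p)
∣image∣ f inj (inside ∷ p) =
  trans (cong ∣_∣ (Subset.⊆-antisym to from))
    (trans (∣p∪⁅x⁆∣ _ (f zero) f0∉) (cong suc (∣image∣ (f ∘ suc) (Fin.suc-injective ∘ inj) p)))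
  where
  f0∉ : f zero ∉ˢ image (f ∘ suc) p
  f0∉ x∈ with i , _ , eq ← ∈-image⁻ (f ∘ suc) p x∈ with () ← inj eq
  to : ∀ {x} → x ∈ˢ image f (inside ∷ p) → x ∈ˢ image (f ∘ suc) p ∪ ⁅ f zero ⁆
  to x∈ with ∈-image⁻ f (inside ∷ p) x∈
  ... | zero , _ , refl = Subset.x∈p∪q⁺ (inj₂ (Subset.x∈⁅x⁆ _))
  ... | suc i , Vec.there i∈p , refl = Subset.x∈p∪q⁺ (inj₁ (∈-image⁺ (f ∘ suc) i∈p))
  from : ∀ {x} → x ∈ˢ image (f ∘ suc) p ∪ ⁅ f zero ⁆ → x ∈ˢ image f (inside ∷ p)
  from x∈ with Subset.x∈p∪q⁻ (image (f ∘ suc) p) _ x∈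
  ... | inj₁ x∈i with i , i∈p , refl ← ∈-image⁻ (f ∘ suc) p x∈i = ∈-image⁺ f {inside ∷ p} (Vec.there i∈p)
  ... | inj₂ x∈f rewrite Subset.x∈⁅y⁆⇒x≡y _ x∈f = ∈-image⁺ f {inside ∷ p} Vec.here

record RGraph (r n : ℕ) : Set where
  constructor mkRGraph
  field
    edges    : List (Subset n)
    uniform  : All (λ e → ∣ e ∣ ≡ r) edges
    distinct : Unique edges

  size : ℕ
  size = length edges

open RGraph public

-- H ⊑ G: G contains a copy of H, not necessarily induced.
infix 4 _⊑_ _⊑?_

_⊑_ : RGraph r k → RGraph r n → Set
_⊑_ {k = k} {n} H G = ∃[ f ] Injective {A = Fin k} {B = Fin n} _≡_ _≡_ f
                           × All (λ e → image f e ∈ edges G) (edges H)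

_⊑?_ : (H : RGraph r k) (G : RGraph r n) → Dec (H ⊑ G)
_⊑?_ {k = k} {n} H G = map′ to from (Fin.any? λ c → injective? (finToFun c) ×-dec embeds? (finToFun c))
  where
  Embeds : (Fin k → Fin n) → Set
  Embeds f = All (λ e → image f e ∈ edges G) (edges H)

  embeds? : ∀ f → Dec (Embeds f)
  embeds? f = All.all? (λ e → image f e ∈? edges G) (edges H)

  injective? : (f : Fin k → Fin n) → Dec (∀ i j → f i ≡ f j → i ≡ j)
  injective? f = Fin.all? λ i → Fin.all? λ j → (f i Fin.≟ f j) →-dec (i Fin.≟ j)

  to : (∃[ c ] (∀ i j → finToFun c i ≡ finToFun c j → i ≡ j) × Embeds (finToFun c)) → H ⊑ G
  to (c , inj , emb) = finToFun c , inj _ _ , emb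

  from : H ⊑ G → ∃[ c ] (∀ i j → finToFun c i ≡ finToFun c j → i ≡ j) × Embeds (finToFun c)
  from (f , inj , emb) = funToFin f
    , (λ i j eq → inj (trans (sym (same i)) (trans eq (same j))))
    , All.map (λ {e} → subst (_∈ edges G) (sym (image-cong same e))) emb
    where
    same : finToFun (funToFin f) ≗ f
    same = Fin.finToFun-funToFin f

subsets : ∀ n → List (Subset n)
subsets zero    = [] ∷ []
subsets (suc n) = map (outside ∷_) (subsets n) ++ map (inside ∷_) (subsets n)

sublists : ∀ {A : Set} → List A → List (List A)
sublists []       = [] ∷ []
sublists (x ∷ xs) = sublists xs ++ map (x ∷_) (sublists xs)

toRGraph : List (Subset n) → Maybe (RGraph r n)
toRGraph {r = r} es with All.all? (λ e → ∣ e ∣ ℕ.≟ r) es | unique? es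
... | yes u | yes d = just (mkRGraph es u d)
... | _     | _     = nothing

-- Every r-graph on Fin n, up to the order in which its edges are listed.
rGraphs : ∀ r n → List (RGraph r n)
rGraphs r n = mapMaybe toRGraph (sublists (subsets n))

-- The maximum is over a nonempty list as soon as H has an edge; see ex-isMaximum.
ex : RGraph r k → ℕ → ℕ
ex {r} H n = max 0 (map size (filter (λ G → ¬? (H ⊑? G)) (rGraphs r n)))

private
  ∈-subsets : (p : Subset n) → p ∈ subsets n
  ∈-subsets [] = here refl
  ∈-subsets (outside ∷ p) = ∈-++⁺ˡ (∈-map⁺ _ (∈-subsets p))
  ∈-subsets (inside  ∷ p) = ∈-++⁺ʳ (map _ (subsets _)) (∈-map⁺ _ (∈-subsets p))

  subsets-unique : ∀ n → Unique (subsets n)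
  subsets-unique zero    = [] ∷ []
  subsets-unique (suc n) = Unique.++⁺ (Unique.map⁺ ∷-inj (subsets-unique n))
                                      (Unique.map⁺ ∷-inj (subsets-unique n)) disj
    where
    ∷-inj : ∀ {s} {p q : Subset n} → _≡_ {A = Subset (suc n)} (s ∷ p) (s ∷ q) → p ≡ q
    ∷-inj refl = refl
    disj : ∀ {p} → ¬ (p ∈ map (outside ∷_) (subsets n) × p ∈ map (inside ∷_) (subsets n))
    disj (p∈ , p∈′) with ∈-map⁻ _ p∈ | ∈-map⁻ _ p∈′
    ... | _ , _ , refl | _ , _ , ()

  ∈-sublists-filter : ∀ {A : Set} {P : A → Set} (P? : ∀ x → Dec (P x)) xs →
                      filter P? xs ∈ sublists xs
  ∈-sublists-filter P? [] = here refl
  ∈-sublists-filter P? (x ∷ xs) with P? x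
  ... | yes _ = ∈-++⁺ʳ (sublists xs) (∈-map⁺ _ (∈-sublists-filter P? xs))
  ... | no  _ = ∈-++⁺ˡ (∈-sublists-filter P? xs)

  toRGraph-complete : ∀ (G : RGraph r n) → Maybe.Any (λ G′ → edges G′ ≡ edges G) (toRGraph {r = r} (edges G))
  toRGraph-complete {r} G with All.all? (λ e → ∣ e ∣ ℕ.≟ r) (edges G) | unique? (edges G)
  ... | yes _ | yes _ = Maybe.just refl
  ... | no ¬u | _     = contradiction (uniform G) ¬u
  ... | yes _ | no ¬d = contradiction (distinct G) ¬d

  rGraphs-complete : ∀ (G : RGraph r n) → edges G ∈ sublists (subsets n) →
                     ∃[ G′ ] G′ ∈ rGraphs r n × edges G′ ≡ edges G
  rGraphs-complete {r} G G∈ = find (Any.mapMaybe⁺ toRGraph _ (Any.map⁺ (lose G∈ (toRGraph-complete G))))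

  lookup-injective : ∀ {A : Set} {xs : List A} → Unique xs → ∀ i j → lookup xs i ≡ lookup xs j → i ≡ j
  lookup-injective {xs = _ ∷ _} _        zero    zero    _  = refl
  lookup-injective {xs = _ ∷ _} (x∉ ∷ _) zero    (suc j) eq = contradiction eq (All.lookup x∉ (∈-lookup j))
  lookup-injective {xs = _ ∷ _} (x∉ ∷ _) (suc i) zero    eq = contradiction (sym eq) (All.lookup x∉ (∈-lookup i))
  lookup-injective {xs = _ ∷ _} (_ ∷ u)  (suc i) (suc j) eq = cong suc (lookup-injective u i j eq)

  length-mono : ∀ {A : Set} {xs ys : List A} → Unique xs → (∀ {x} → x ∈ xs → x ∈ ys) → length xs ≤ length ys
  length-mono {xs = xs} {ys} u xs⊆ys = Fin.injective⇒≤ {f = f} f-inj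
    where
    f : Fin (length xs) → Fin (length ys)
    f i = index (xs⊆ys (∈-lookup {xs = xs} i))
    f-inj : Injective _≡_ _≡_ f
    f-inj {i} {j} eq = lookup-injective u i j
      (trans (Any.lookup-index (xs⊆ys (∈-lookup {xs = xs} i)))
        (trans (cong (lookup ys) eq) (sym (Any.lookup-index (xs⊆ys (∈-lookup {xs = xs} j))))))

record IsTuránNumber (H : RGraph r k) (n v : ℕ) : Set where
  field
    attained : ∃[ G ] ¬ H ⊑ G × size {r} {n} G ≡ v
    bound    : ∀ (G : RGraph r n) → ¬ H ⊑ G → size G ≤ v

ex-isMaximum : ∀ (H : RGraph r k) → edges H ≢ [] → ∀ n → IsTuránNumber H n (ex H n)
ex-isMaximum {r} H H≢[] n = record { attained = att ; bound = bnd }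
  where
  free? : (G : RGraph r n) → Dec (¬ H ⊑ G)
  free? G = ¬? (H ⊑? G)

  frees : List (RGraph r n)
  frees = filter free? (rGraphs r n)

  none : RGraph r n
  none = mkRGraph [] [] []

  none-free : ¬ H ⊑ none
  none-free (_ , _ , emb) with edges H
  none-free (_ , _ , []) | [] = H≢[] refl
  none-free (_ , _ , () ∷ _) | _ ∷ _

  att : ∃[ G ] ¬ H ⊑ G × size G ≡ ex H n
  att with argmax-sel id 0 (map size frees)
  ... | inj₁ eq = none , none-free , sym eq
  ... | inj₂ ∈s with G , G∈ , eq ← ∈-map⁻ size ∈s =
    G , proj₂ (∈-filter⁻ free? {xs = rGraphs r n} G∈) , sym eq

  bnd : ∀ G → ¬ H ⊑ G → size G ≤ ex H n
  bnd G G-free = ℕ.≤-trans size≤ (All.lookup (xs≤max 0 (map size frees))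
    (∈-map⁺ size (∈-filter⁺ free? G′∈ G′-free)))
    where
    es : List (Subset n)
    es = filter (_∈? edges G) (subsets n)
    es⊆ : ∀ {e} → e ∈ es → e ∈ edges G
    es⊆ = proj₂ ∘ ∈-filter⁻ (_∈? edges G) {xs = subsets n}
    G″ : RGraph r n
    G″ = mkRGraph es (All.tabulate (All.lookup (uniform G) ∘ es⊆))
                     (Unique.filter⁺ (_∈? edges G) (subsets-unique n))
    found : ∃[ G′ ] G′ ∈ rGraphs r n × edges G′ ≡ es
    found = rGraphs-complete G″ (∈-sublists-filter (_∈? edges G) (subsets n))
    G′ = proj₁ found
    G′∈ = proj₁ (proj₂ found)
    same = proj₂ (proj₂ found)
    G′-free : ¬ H ⊑ G′
    G′-free (f , inj , emb) = G-free (f , inj , All.map (λ e∈ → es⊆ (subst (_ ∈_) same e∈)) emb)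
    size≤ : size G ≤ size G′
    size≤ = length-mono (distinct G) λ {e} e∈ →
      subst (e ∈_) (sym same) (∈-filter⁺ (_∈? edges G) (∈-subsets e) e∈)

module CompleteBipartite (r s t : ℕ) where

  Vertices : ℕ
  Vertices = t * (r ∸ 1) + s

  x : Fin t → Fin (r ∸ 1) → Fin Vertices
  x i a = combine i a ↑ˡ s

  y : Fin s → Fin Vertices
  y b = (t * (r ∸ 1)) ↑ʳ b

  X : Fin t → Subset Vertices
  X i = image (x i) ⊤

  edge : Fin t → Fin s → Subset Vertices
  edge i b = X i ∪ ⁅ y b ⁆

  x≢y : ∀ {i a b} → x i a ≢ y b
  x≢y {i} {a} {b} eq with () ← trans (sym (Fin.splitAt-↑ˡ (t * (r ∸ 1)) (combine i a) s))
    (trans (cong (splitAt (t * (r ∸ 1))) eq) (Fin.splitAt-↑ʳ (t * (r ∸ 1)) s b))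

  x-injective : ∀ {i j a b} → x i a ≡ x j b → i ≡ j × a ≡ b
  x-injective {i} {j} {a} {b} eq = Fin.combine-injective i a j b (Fin.↑ˡ-injective s _ _ eq)

  y∉X : ∀ {i b} → y b ∉ˢ X i
  y∉X {i} y∈ with _ , _ , eq ← ∈-image⁻ (x i) ⊤ y∈ = x≢y eq

  ∣edge∣ : 2 ≤ r → ∀ i b → ∣ edge i b ∣ ≡ r
  ∣edge∣ 2≤r i b = trans (∣p∪⁅x⁆∣ (X i) (y b) y∉X)
    (trans (cong suc (trans (∣image∣ (x i) (proj₂ ∘ x-injective) ⊤) (Subset.∣⊤∣≡n _)))
           (ℕ.m+[n∸m]≡n (ℕ.<⇒≤ 2≤r)))

  edge-injective : 2 ≤ r → ∀ {i j b c} → edge i b ≡ edge j c → i ≡ j × b ≡ c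
  edge-injective (s≤s (s≤s _)) {i} {j} {b} {c} eq = i≡j , b≡c
    where
    i≡j : i ≡ j
    i≡j with Subset.x∈p∪q⁻ (X j) _ (subst (x i zero ∈ˢ_) eq
               (Subset.x∈p∪q⁺ (inj₁ (∈-image⁺ (x i) Subset.∈⊤))))
    ... | inj₁ ∈X with _ , _ , eq′ ← ∈-image⁻ (x j) ⊤ ∈X = sym (proj₁ (x-injective eq′))
    ... | inj₂ ∈y = contradiction (Subset.x∈⁅y⁆⇒x≡y _ ∈y) x≢y
    b≡c : b ≡ c
    b≡c with Subset.x∈p∪q⁻ (X j) _ (subst (y b ∈ˢ_) eq
               (Subset.x∈p∪q⁺ {p = X i} (inj₂ (Subset.x∈⁅x⁆ (y b)))))
    ... | inj₁ ∈X = contradiction ∈X y∉X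
    ... | inj₂ ∈y = Fin.↑ʳ-injective (t * (r ∸ 1)) _ _ (Subset.x∈⁅y⁆⇒x≡y _ ∈y)

-- |Y| = s and there are t blocks X i of size r − 1.  For r = 1 the blocks would be empty and
-- the edges X i ∪ {y} would not depend on i, hence the hypothesis 2 ≤ r.
K : ∀ r s t → 2 ≤ r → RGraph r (t * (r ∸ 1) + s)
K r s t 2≤r = record
  { edges    = cartesianProductWith edge (allFin t) (allFin s)
  ; uniform  = All.tabulate λ e∈ → let i , b , _ , _ , eq = ∈-cartesianProductWith⁻ edge (allFin t) (allFin s) e∈
                                   in trans (cong ∣_∣ eq) (∣edge∣ 2≤r i b)
  ; distinct = Unique.cartesianProductWith⁺ edge (edge-injective 2≤r) (Unique.allFin⁺ t) (Unique.allFin⁺ s)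
  }
  where open CompleteBipartite r s t

-- Growth rates with a rational exponent p / q, for q ≥ 1:
-- f n ≤ C n^(p/q) for all large n, both sides raised to the q-th power.
-- Restricting C to ℕ is harmless, since any real constant may be rounded up.

_=O[n^_/_] : (ℕ → ℕ) → ℕ → ℕ → Set
f =O[n^ p / q ] = ∃[ C ] ∃[ N ] ∀ n → N ≤ n → f n ^ q ≤ C ^ q * n ^ p

{-# OPTIONS --safe #-}

-- Kővári–Sós–Turán, applied between vertices y and words w ∈ [n]^(r−1) such that y ∷ w orders an
-- edge.  Let d(y) be the number of such w.  At most c n^(r−2) words meet a given set of t(r−1)
-- letters, c = (r−1) t (r−1), so with a(y) = d(y) ∸ c n^(r−2) at least a(y)^t tuples of t disjoint
-- words are joined to y.  In a K-free graph a disjoint t-tuple has fewer than s common neighbours,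
-- hence Σ a(y)^t ≤ s n^((r−1)t); by the power mean inequality (up to the factor 2^t) Σ a(y) is
-- O(n^(r−1/t)), and the number of edges is at most Σ d(y) ≤ Σ a(y) + c n^(r−1).
module Submission where

import Algebra.Properties.CommutativeSemigroup as CommSemigroup
open import Data.Nat using (ℕ; zero; suc; _+_; _*_; _∸_; _^_; _≤_; z≤n; s≤s; NonZero; >-nonZero)
open import Data.Nat.Properties
open import Data.Nat.ListAction using (sum)
open import Data.Nat.ListAction.Properties using (sum-++)
open import Data.Nat.Tactic.RingSolver using (solve-∀)
open import Data.List using (List; []; _∷_; _++_; map; filter; length; lookup; allFin; cartesianProductWith)
open import Data.List.Properties using (map-++; map-∘; map-cong; length-map; length-tabulate)
import Data.List.Membership.DecPropositional as MembershipDec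
open import Data.List.Membership.Propositional using (_∈_)
open import Data.List.Membership.Propositional.Properties
  using (∈-lookup; ∈-allFin; ∈-cartesianProductWith⁺; ∈-cartesianProductWith⁻; ∈-filter⁺; ∈-filter⁻; ∈-map⁺)
open import Data.List.Relation.Unary.Any using (here; index)
open import Data.List.Relation.Unary.Any.Properties using (lookup-index)
open import Data.List.Relation.Unary.Unique.Propositional using (Unique)
import Data.List.Relation.Unary.Unique.Propositional.Properties as Unique
import Data.List.Relation.Unary.All as All
open import Data.List.Relation.Unary.AllPairs using ([]; _∷_)
open import Data.Vec as Vec using (Vec; []; _∷_)
import Data.Vec.Properties as Vec
open import Data.Vec.Relation.Unary.All as Allᵛ using ([]; _∷_) renaming (All to Allᵛ)
import Data.Vec.Relation.Unary.All.Properties as Allᵛ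
open import Data.Vec.Relation.Unary.AllPairs as AllPairsᵛ using ([]; _∷_)
import Data.Vec.Relation.Unary.AllPairs.Properties as AllPairsᵛ
open import Data.Vec.Relation.Unary.Unique.Propositional using () renaming (Unique to Uniqueᵛ)
import Data.Vec.Relation.Unary.Unique.Propositional.Properties as Uniqueᵛ
open import Data.Fin using (Fin; zero; suc; combine; inject≤)
open import Data.Fin.Properties using (injective⇒≤; inject≤-injective) renaming (_≟_ to _≟ᶠ_; suc-injective to sucᶠ-injective)
open import Data.Fin.Subset using (Subset; inside; outside; ⊤; ∣_∣) renaming (_∈_ to _∈ˢ_)
import Data.Fin.Subset.Properties as Subset
open import Data.Empty using (⊥-elim)
open import Data.Product using (∃-syntax; _×_; _,_; proj₁; proj₂)
open import Data.Sum using (_⊎_; inj₁; inj₂; [_,_]′)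
open import Function using (_∘_)
open import Relation.Binary.PropositionalEquality
open import Relation.Nullary using (¬_; Dec; yes; no; ¬?; _×-dec_; contradiction)
open import Defs

private
  module +-CommutativeSemigroup = CommSemigroup +-commutativeSemigroup
  module *-CommutativeSemigroup = CommSemigroup *-commutativeSemigroup

private variable
  A B P Q R : Set
  k l m n : ℕ

-- Finite sums and indicators of decidable propositions.

∑ : List A → (A → ℕ) → ℕ
∑ xs f = sum (map f xs)

∑-mono : ∀ (xs : List A) {f g : A → ℕ} → (∀ x → f x ≤ g x) → ∑ xs f ≤ ∑ xs g
∑-mono []       f≤g = z≤n
∑-mono (x ∷ xs) f≤g = +-mono-≤ (f≤g x) (∑-mono xs f≤g)

∑-const : ∀ (xs : List A) c → ∑ xs (λ _ → c) ≡ length xs * c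
∑-const []       c = refl
∑-const (x ∷ xs) c = cong (c +_) (∑-const xs c)

∑-+ : ∀ (xs : List A) (f g : A → ℕ) → ∑ xs (λ x → f x + g x) ≡ ∑ xs f + ∑ xs g
∑-+ []       f g = refl
∑-+ (x ∷ xs) f g = trans (cong (f x + g x +_) (∑-+ xs f g)) (+-CommutativeSemigroup.interchange (f x) (g x) _ _)

*-distribˡ-∑ : ∀ (xs : List A) c (f : A → ℕ) → c * ∑ xs f ≡ ∑ xs (λ x → c * f x)
*-distribˡ-∑ []       c f = *-zeroʳ c
*-distribˡ-∑ (x ∷ xs) c f = trans (*-distribˡ-+ c (f x) _) (cong (c * f x +_) (*-distribˡ-∑ xs c f))

*-distribʳ-∑ : ∀ (xs : List A) c (f : A → ℕ) → ∑ xs f * c ≡ ∑ xs (λ x → f x * c)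
*-distribʳ-∑ []       c f = refl
*-distribʳ-∑ (x ∷ xs) c f = trans (*-distribʳ-+ c (f x) _) (cong (f x * c +_) (*-distribʳ-∑ xs c f))

∑-swap : ∀ (xs : List A) (ys : List B) (f : A → B → ℕ) →
         ∑ xs (λ x → ∑ ys (f x)) ≡ ∑ ys (λ y → ∑ xs (λ x → f x y))
∑-swap []       ys f = sym (trans (∑-const ys 0) (*-zeroʳ (length ys)))
∑-swap (x ∷ xs) ys f = trans (cong (∑ ys (f x) +_) (∑-swap xs ys f)) (sym (∑-+ ys (f x) _))

∑-cartesianProductWith : ∀ {C : Set} (c : A → B → C) xs ys (f : C → ℕ) →
  ∑ (cartesianProductWith c xs ys) f ≡ ∑ xs (λ x → ∑ ys (f ∘ c x))
∑-cartesianProductWith c []       ys f = refl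
∑-cartesianProductWith c (x ∷ xs) ys f = begin
  sum (map f (map (c x) ys ++ cartesianProductWith c xs ys))
    ≡⟨ cong sum (map-++ f (map (c x) ys) _) ⟩
  sum (map f (map (c x) ys) ++ map f (cartesianProductWith c xs ys))
    ≡⟨ sum-++ (map f (map (c x) ys)) _ ⟩
  sum (map f (map (c x) ys)) + ∑ (cartesianProductWith c xs ys) f
    ≡⟨ cong₂ _+_ (cong sum (sym (map-∘ ys))) (∑-cartesianProductWith c xs ys f) ⟩
  ∑ ys (f ∘ c x) + ∑ xs (λ x → ∑ ys (f ∘ c x)) ∎
  where open ≡-Reasoning

⟦_⟧ : Dec P → ℕ
⟦ yes _ ⟧ = 1
⟦ no  _ ⟧ = 0

⟦⟧-⊎ : (P? : Dec P) (Q? : Dec Q) (R? : Dec R) → (P → Q ⊎ R) → ⟦ P? ⟧ ≤ ⟦ Q? ⟧ + ⟦ R? ⟧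
⟦⟧-⊎ (no  _) _       _       _ = z≤n
⟦⟧-⊎ (yes p) (yes _) _       _ = s≤s z≤n
⟦⟧-⊎ (yes p) (no _)  (yes _) _ = s≤s z≤n
⟦⟧-⊎ (yes p) (no ¬q) (no ¬r) f = contradiction (f p) [ ¬q , ¬r ]′

⟦⟧-× : (P? : Dec P) (Q? : Dec Q) (R? : Dec R) → (P → Q → R) → ⟦ P? ⟧ * ⟦ Q? ⟧ ≤ ⟦ R? ⟧
⟦⟧-× (no  _) _       _       _ = z≤n
⟦⟧-× (yes _) (no _)  _       _ = z≤n
⟦⟧-× (yes _) (yes _) (yes _) _ = s≤s z≤n
⟦⟧-× (yes p) (yes q) (no ¬r) f = contradiction (f p q) ¬r

∑-⟦⟧ : ∀ {P : A → Set} (P? : ∀ x → Dec (P x)) xs → ∑ xs (λ x → ⟦ P? x ⟧) ≡ length (filter P? xs)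
∑-⟦⟧ P? []       = refl
∑-⟦⟧ P? (x ∷ xs) with P? x
... | yes _ = cong suc (∑-⟦⟧ P? xs)
... | no  _ = ∑-⟦⟧ P? xs

lookup-injective : ∀ {xs : List A} → Unique xs → ∀ i j → lookup xs i ≡ lookup xs j → i ≡ j
lookup-injective {xs = _ ∷ _} _        zero    zero    _  = refl
lookup-injective {xs = _ ∷ _} (x∉ ∷ _) zero    (suc j) eq = contradiction eq (All.lookup x∉ (∈-lookup j))
lookup-injective {xs = _ ∷ _} (x∉ ∷ _) (suc i) zero    eq = contradiction (sym eq) (All.lookup x∉ (∈-lookup i))
lookup-injective {xs = _ ∷ _} (_ ∷ u)  (suc i) (suc j) eq = cong suc (lookup-injective u i j eq)

-- Sending each position of `xs` to a position of the same entry in `ys` is injective, since `xs`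
-- has no repetitions.
unique-⊆⇒length≤ : ∀ {xs ys : List A} → Unique xs → (∀ {x} → x ∈ xs → x ∈ ys) → length xs ≤ length ys
unique-⊆⇒length≤ {xs = xs} {ys} u xs⊆ys = injective⇒≤ {f = λ i → index (∈ys i)} λ {i} {j} eq →
  lookup-injective u i j
    (trans (lookup-index (∈ys i)) (trans (cong (lookup ys) eq) (sym (lookup-index (∈ys j)))))
  where
  ∈ys : ∀ i → lookup xs i ∈ ys
  ∈ys i = xs⊆ys (∈-lookup i)

-- Inequalities between powers of natural numbers.

^-distribʳ-* : ∀ a b k → (a * b) ^ k ≡ a ^ k * b ^ k
^-distribʳ-* a b zero    = refl
^-distribʳ-* a b (suc k) = trans (cong (a * b *_) (^-distribʳ-* a b k)) (*-CommutativeSemigroup.interchange a b (a ^ k) (b ^ k))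

-- A crude form of Young's inequality: replacing the smaller of a and b by the larger leaves a pure
-- power, with no weights and no division.
a*b^k≤a^[1+k]+b^[1+k] : ∀ a b k → a * b ^ k ≤ a ^ suc k + b ^ suc k
a*b^k≤a^[1+k]+b^[1+k] a b k with ≤-total a b
... | inj₁ a≤b = ≤-trans (*-monoˡ-≤ (b ^ k) a≤b) (m≤n+m _ _)
... | inj₂ b≤a = ≤-trans (*-monoʳ-≤ a (^-monoˡ-≤ k b≤a)) (m≤m+n _ _)

-- With S = ∑ f and N = length xs, add up 2N f(x) Sᵏ ≤ (2N f(x))ᵏ⁺¹ + Sᵏ⁺¹ and cancel N Sᵏ⁺¹.
power-mean : ∀ (xs : List A) (f : A → ℕ) k →
  length xs * ∑ xs f ^ suc k ≤ (2 * length xs) ^ suc k * ∑ xs (λ x → f x ^ suc k)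
power-mean xs f k = +-cancelʳ-≤ (N * S ^ suc k) _ _ (begin
  N * (S * S ^ k) + N * (S * S ^ k)
    ≡⟨ double N S (S ^ k) ⟩
  2 * N * S * S ^ k
    ≡⟨ cong (_* S ^ k) (*-distribˡ-∑ xs (2 * N) f) ⟩
  ∑ xs (λ x → 2 * N * f x) * S ^ k
    ≡⟨ *-distribʳ-∑ xs (S ^ k) _ ⟩
  ∑ xs (λ x → 2 * N * f x * S ^ k)
    ≤⟨ ∑-mono xs (λ x → ≤-trans (a*b^k≤a^[1+k]+b^[1+k] (2 * N * f x) S k)
         (+-monoˡ-≤ _ (≤-reflexive (^-distribʳ-* (2 * N) (f x) (suc k))))) ⟩
  ∑ xs (λ x → (2 * N) ^ suc k * f x ^ suc k + S ^ suc k)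
    ≡⟨ ∑-+ xs _ _ ⟩
  ∑ xs (λ x → (2 * N) ^ suc k * f x ^ suc k) + ∑ xs (λ _ → S ^ suc k)
    ≡⟨ cong₂ _+_ (sym (*-distribˡ-∑ xs ((2 * N) ^ suc k) _)) (∑-const xs _) ⟩
  (2 * N) ^ suc k * ∑ xs (λ x → f x ^ suc k) + N * S ^ suc k ∎)
  where
  open ≤-Reasoning
  N = length xs
  S = ∑ xs f
  double : ∀ a b c → a * (b * c) + a * (b * c) ≡ 2 * a * b * c
  double = solve-∀

-- The sum inside is at most twice its larger term.
[a+b]^k≤2^k*[a^k+b^k] : ∀ a b k → (a + b) ^ k ≤ 2 ^ k * (a ^ k + b ^ k)
[a+b]^k≤2^k*[a^k+b^k] a b k with ≤-total a b
... | inj₁ a≤b = ≤-trans (^-monoˡ-≤ k (≤-trans (+-monoˡ-≤ b a≤b) (+-monoʳ-≤ b (≤-reflexive (sym (+-identityʳ b))))))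
  (≤-trans (≤-reflexive (^-distribʳ-* 2 b k)) (*-monoʳ-≤ (2 ^ k) (m≤n+m _ _)))
... | inj₂ b≤a = ≤-trans (^-monoˡ-≤ k (+-monoʳ-≤ a (≤-trans b≤a (≤-reflexive (sym (+-identityʳ a))))))
  (≤-trans (≤-reflexive (^-distribʳ-* 2 a k)) (*-monoʳ-≤ (2 ^ k) (m≤m+n _ _)))

-- Lets a constant factor grow into a perfect power, the form that `_=O[n^_/_]` asks of its
-- constant.
m≤m^[1+k] : ∀ m k → m ≤ m ^ suc k
m≤m^[1+k] zero    k = z≤n
m≤m^[1+k] (suc m) k = m≤m*n (suc m) (suc m ^ k) {{m^n≢0 (suc m) k}}

-- Words over the vertex set, and the number of those that meet a given word.

words : ∀ n k → List (Vec (Fin n) k)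
words n zero    = [] ∷ []
words n (suc k) = cartesianProductWith _∷_ (allFin n) (words n k)

∈-words : (w : Vec (Fin n) k) → w ∈ words n k
∈-words []      = here refl
∈-words (x ∷ w) = ∈-cartesianProductWith⁺ _∷_ (∈-allFin x) (∈-words w)

∑-allFin-const : ∀ n c → ∑ (allFin n) (λ _ → c) ≡ n * c
∑-allFin-const n c = trans (∑-const (allFin n) c) (cong (_* c) (length-tabulate {n = n} _))

∑-words-const : ∀ n k c → ∑ (words n k) (λ _ → c) ≡ n ^ k * c
∑-words-const n zero    c = refl
∑-words-const n (suc k) c = begin
  ∑ (words n (suc k)) (λ _ → c)                        ≡⟨ ∑-cartesianProductWith _∷_ (allFin n) (words n k) _ ⟩
  ∑ (allFin n) (λ _ → ∑ (words n k) (λ _ → c))         ≡⟨ ∑-allFin-const n _ ⟩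
  n * ∑ (words n k) (λ _ → c)                          ≡⟨ cong (n *_) (∑-words-const n k c) ⟩
  n * (n ^ k * c)                                      ≡⟨ *-assoc n (n ^ k) c ⟨
  n ^ suc k * c                                        ∎
  where open ≡-Reasoning

Disjoint : Vec (Fin n) k → Vec (Fin n) l → Set
Disjoint w v = Allᵛ (λ x → Allᵛ (x ≢_) v) w

fresh? : (v : Vec (Fin n) l) (x : Fin n) → Dec (Allᵛ (x ≢_) v)
fresh? v x = Allᵛ.all? (λ y → ¬? (x ≟ᶠ y)) v

disjoint? : (w : Vec (Fin n) k) (v : Vec (Fin n) l) → Dec (Disjoint w v)
disjoint? w v = Allᵛ.all? (fresh? v) w

uniqueᵛ? : (v : Vec (Fin n) l) → Dec (Uniqueᵛ v)
uniqueᵛ? = AllPairsᵛ.allPairs? λ x y → ¬? (x ≟ᶠ y)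

-- Union bound over the entries of `v`, each of which excludes a single letter.
∑-¬fresh : (v : Vec (Fin n) l) → ∑ (allFin n) (λ x → ⟦ ¬? (fresh? v x) ⟧) ≤ l
∑-¬fresh {n} [] = ≤-reflexive (trans (∑-allFin-const n 0) (*-zeroʳ n))
∑-¬fresh {n} {suc l} (y ∷ v) = begin
  ∑ (allFin n) (λ x → ⟦ ¬? (fresh? (y ∷ v) x) ⟧)
    ≤⟨ ∑-mono (allFin n) (λ x → ⟦⟧-⊎ (¬? (fresh? (y ∷ v) x)) (x ≟ᶠ y) (¬? (fresh? v x)) (split x)) ⟩
  ∑ (allFin n) (λ x → ⟦ x ≟ᶠ y ⟧ + ⟦ ¬? (fresh? v x) ⟧)
    ≡⟨ ∑-+ (allFin n) _ _ ⟩
  ∑ (allFin n) (λ x → ⟦ x ≟ᶠ y ⟧) + ∑ (allFin n) (λ x → ⟦ ¬? (fresh? v x) ⟧)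
    ≤⟨ +-mono-≤ (≤-trans (≤-reflexive (∑-⟦⟧ (_≟ᶠ y) (allFin n))) one) (∑-¬fresh v) ⟩
  suc l ∎
  where
  open ≤-Reasoning
  split : ∀ x → ¬ Allᵛ (x ≢_) (y ∷ v) → x ≡ y ⊎ ¬ Allᵛ (x ≢_) v
  split x ¬all with x ≟ᶠ y
  ... | yes x≡y = inj₁ x≡y
  ... | no  x≢y = inj₂ λ all → ¬all (x≢y ∷ all)
  one : length (filter (_≟ᶠ y) (allFin n)) ≤ 1
  one = unique-⊆⇒length≤ {ys = y ∷ []} (Unique.filter⁺ (_≟ᶠ y) (Unique.allFin⁺ n))
    λ x∈ → here (proj₂ (∈-filter⁻ (_≟ᶠ y) {xs = allFin n} x∈))

-- Union bound over the k * l ways in which a position of the word can carry an entry of `v`; the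
-- other k - 1 positions are free.
∑-¬disjoint : ∀ k (v : Vec (Fin n) l) → ∑ (words n k) (λ w → ⟦ ¬? (disjoint? w v) ⟧) ≤ k * l * n ^ (k ∸ 1)
∑-¬disjoint zero v = z≤n
∑-¬disjoint {n} {l} (suc k) v = begin
  ∑ (words n (suc k)) (λ w → ⟦ ¬? (disjoint? w v) ⟧)
    ≡⟨ ∑-cartesianProductWith _∷_ (allFin n) (words n k) _ ⟩
  ∑ (allFin n) (λ x → ∑ (words n k) (λ w → ⟦ ¬? (disjoint? (x ∷ w) v) ⟧))
    ≤⟨ ∑-mono (allFin n) (λ x → ∑-mono (words n k) λ w →
         ⟦⟧-⊎ (¬? (disjoint? (x ∷ w) v)) (¬? (fresh? v x)) (¬? (disjoint? w v)) (split x w)) ⟩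
  ∑ (allFin n) (λ x → ∑ (words n k) (λ w → ⟦ ¬? (fresh? v x) ⟧ + ⟦ ¬? (disjoint? w v) ⟧))
    ≡⟨ trans (cong sum (map-cong (λ x → trans (∑-+ (words n k) _ _) (cong (_+ D) (∑-words-const n k _))) (allFin n)))
             (∑-+ (allFin n) _ _) ⟩
  ∑ (allFin n) (λ x → n ^ k * ⟦ ¬? (fresh? v x) ⟧) + ∑ (allFin n) (λ _ → D)
    ≡⟨ cong₂ _+_ (sym (*-distribˡ-∑ (allFin n) (n ^ k) _)) (∑-allFin-const n D) ⟩
  n ^ k * ∑ (allFin n) (λ x → ⟦ ¬? (fresh? v x) ⟧) + n * D
    ≤⟨ +-mono-≤ (*-monoʳ-≤ (n ^ k) (∑-¬fresh v)) (*-monoʳ-≤ n (∑-¬disjoint k v)) ⟩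
  n ^ k * l + n * (k * l * n ^ (k ∸ 1))
    ≡⟨ collect k ⟩
  suc k * l * n ^ k ∎
  where
  open ≤-Reasoning
  D = ∑ (words n k) (λ w → ⟦ ¬? (disjoint? w v) ⟧)
  split : ∀ x w → ¬ Disjoint (x ∷ w) v → ¬ Allᵛ (x ≢_) v ⊎ ¬ Disjoint w v
  split x w ¬disj with fresh? v x
  ... | yes x∉v = inj₂ λ disj → ¬disj (x∉v ∷ disj)
  ... | no  x∈v = inj₁ x∈v
  base : ∀ n l → 1 * l + n * 0 ≡ (l + 0) * 1
  base = solve-∀
  step : ∀ n l k q → n * q * l + n * (suc k * l * q) ≡ suc (suc k) * l * (n * q)
  step = solve-∀
  -- At k = 0 the exponent `k ∸ 1` is truncated, but the factor k already makes that term vanish.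
  collect : ∀ k → n ^ k * l + n * (k * l * n ^ (k ∸ 1)) ≡ suc k * l * n ^ k
  collect zero    = base n l
  collect (suc k) = step n l k (n ^ k)

-- Orderings of a subset as words with distinct letters.

⟪_⟫ : Vec (Fin n) k → Subset n
⟪ v ⟫ = image (Vec.lookup v) ⊤

∈-⟪⟫⁻ : ∀ (v : Vec (Fin n) k) {x} → x ∈ˢ ⟪ v ⟫ → ∃[ i ] Vec.lookup v i ≡ x
∈-⟪⟫⁻ v x∈ with i , _ , eq ← ∈-image⁻ (Vec.lookup v) ⊤ x∈ = i , eq

elements : (p : Subset n) → Vec (Fin n) ∣ p ∣
elements []            = []
elements (inside  ∷ p) = zero ∷ Vec.map suc (elements p)
elements (outside ∷ p) = Vec.map suc (elements p)

elements-unique : (p : Subset n) → Uniqueᵛ (elements p)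
elements-unique []            = []
elements-unique (inside  ∷ p) = Allᵛ.map⁺ (Allᵛ.universal (λ _ ()) _) ∷ Uniqueᵛ.map⁺ sucᶠ-injective (elements-unique p)
elements-unique (outside ∷ p) = Uniqueᵛ.map⁺ sucᶠ-injective (elements-unique p)

lookup-elements-∈ : ∀ (p : Subset n) i → Vec.lookup (elements p) i ∈ˢ p
lookup-elements-∈ (inside  ∷ p) zero    = Vec.here
lookup-elements-∈ (inside  ∷ p) (suc i) =
  subst (_∈ˢ _) (sym (Vec.lookup-map i suc (elements p))) (Vec.there (lookup-elements-∈ p i))
lookup-elements-∈ (outside ∷ p) i =
  subst (_∈ˢ _) (sym (Vec.lookup-map i suc (elements p))) (Vec.there (lookup-elements-∈ p i))

∈⇒lookup-elements : ∀ (p : Subset n) {x} → x ∈ˢ p → ∃[ i ] Vec.lookup (elements p) i ≡ x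
∈⇒lookup-elements (inside  ∷ p) Vec.here = zero , refl
∈⇒lookup-elements (inside  ∷ p) (Vec.there x∈) with i , refl ← ∈⇒lookup-elements p x∈ =
  suc i , Vec.lookup-map i suc (elements p)
∈⇒lookup-elements (outside ∷ p) (Vec.there x∈) with i , refl ← ∈⇒lookup-elements p x∈ =
  i , Vec.lookup-map i suc (elements p)

⟪elements⟫ : (p : Subset n) → ⟪ elements p ⟫ ≡ p
⟪elements⟫ p = Subset.⊆-antisym to from
  where
  to : ∀ {x} → x ∈ˢ ⟪ elements p ⟫ → x ∈ˢ p
  to x∈ with i , refl ← ∈-⟪⟫⁻ (elements p) x∈ = lookup-elements-∈ p i
  from : ∀ {x} → x ∈ˢ p → x ∈ˢ ⟪ elements p ⟫
  from x∈ with i , refl ← ∈⇒lookup-elements p x∈ = ∈-image⁺ (Vec.lookup (elements p)) Subset.∈⊤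

-- Ordered edges, degrees and common neighbours.

module Links (G : RGraph (suc m) n) where

  open MembershipDec (_≟ˢ_ {n}) using (_∈?_)

  -- Distinctness is recorded with the edge because it is read off later: it separates a vertex from
  -- the word joined to it, and lets disjoint words be concatenated.
  IsEdge : Vec (Fin n) (suc m) → Set
  IsEdge v = Uniqueᵛ v × ⟪ v ⟫ ∈ edges G

  isEdge? : ∀ v → Dec (IsEdge v)
  isEdge? v = uniqueᵛ? v ×-dec (⟪ v ⟫ ∈? edges G)

  -- Words are ordered, so this is m! times the usual degree of y.
  degree : Fin n → ℕ
  degree y = ∑ (words n m) (λ w → ⟦ isEdge? (y ∷ w) ⟧)

  -- Every edge has at least one ordering, and different edges have different ones. The overcount by
  -- a factor (m + 1)! only helps.
  size≤∑degree : size G ≤ ∑ (allFin n) degree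
  size≤∑degree = begin
    size G                                         ≤⟨ unique-⊆⇒length≤ (distinct G) ordered ⟩
    length (map ⟪_⟫ (filter isEdge? (words n (suc m)))) ≡⟨ length-map ⟪_⟫ (filter isEdge? (words n (suc m))) ⟩
    length (filter isEdge? (words n (suc m)))      ≡⟨ ∑-⟦⟧ isEdge? (words n (suc m)) ⟨
    ∑ (words n (suc m)) (λ v → ⟦ isEdge? v ⟧)      ≡⟨ ∑-cartesianProductWith _∷_ (allFin n) (words n m) _ ⟩
    ∑ (allFin n) degree                            ∎
    where
    open ≤-Reasoning
    ordering : ∀ e → ∣ e ∣ ≡ suc m → ∃[ v ] Uniqueᵛ {n = suc m} v × ⟪ v ⟫ ≡ e
    ordering e eq = subst (λ k → ∃[ v ] Uniqueᵛ {n = k} v × ⟪ v ⟫ ≡ e) eq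
      (elements e , elements-unique e , ⟪elements⟫ e)
    ordered : ∀ {e} → e ∈ edges G → e ∈ map ⟪_⟫ (filter isEdge? (words n (suc m)))
    ordered {e} e∈ with v , v! , refl ← ordering e (All.lookup (uniform G) e∈) =
      ∈-map⁺ ⟪_⟫ (∈-filter⁺ isEdge? (∈-words v) (v! , e∈))

  -- A product of indicators, so that the factor independent of `y` can be taken out of a sum over
  -- `y`.
  extension : Fin n → Vec (Fin n) l → Vec (Fin n) m → ℕ
  extension y v w = ⟦ uniqueᵛ? (w Vec.++ v) ⟧ * ⟦ isEdge? (y ∷ w) ⟧

  -- A word joined to `y` either meets `v`, which `∑-¬disjoint` bounds, or is disjoint from it. In
  -- the latter case both words have distinct letters, hence so does their concatenation.
  degree≤extensions : ∀ (v : Vec (Fin n) l) → Uniqueᵛ v → ∀ y →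
    degree y ≤ m * l * n ^ (m ∸ 1) + ∑ (words n m) (extension y v)
  degree≤extensions {l} v v! y = begin
    degree y
      ≤⟨ ∑-mono (words n m) pointwise ⟩
    ∑ (words n m) (λ w → ⟦ ¬? (disjoint? w v) ⟧ + extension y v w)
      ≡⟨ ∑-+ (words n m) _ _ ⟩
    ∑ (words n m) (λ w → ⟦ ¬? (disjoint? w v) ⟧) + ∑ (words n m) (extension y v)
      ≤⟨ +-monoˡ-≤ _ (∑-¬disjoint m v) ⟩
    m * l * n ^ (m ∸ 1) + ∑ (words n m) (extension y v) ∎
    where
    open ≤-Reasoning
    pointwise : ∀ w → ⟦ isEdge? (y ∷ w) ⟧ ≤ ⟦ ¬? (disjoint? w v) ⟧ + extension y v w
    pointwise w with isEdge? (y ∷ w) | disjoint? w v | uniqueᵛ? (w Vec.++ v)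
    ... | no _             | _        | _       = z≤n
    ... | yes _            | no _     | _       = s≤s z≤n
    ... | yes _            | yes _    | yes _   = ≤-refl
    ... | yes (_ ∷ w! , _) | yes disj | no ¬u   = contradiction (AllPairsᵛ.++⁺ w! v! disj) ¬u

  Common : Vec (Vec (Fin n) m) k → Fin n → Set
  Common us y = Allᵛ (λ u → IsEdge (y ∷ u)) us

  common? : ∀ (us : Vec (Vec (Fin n) m) k) y → Dec (Common us y)
  common? us y = Allᵛ.all? (λ u → isEdge? (y ∷ u)) us

  -- With s or more common neighbours, the words of `us` serve as the blocks X i and s of these
  -- neighbours as Y, which gives a forbidden copy.
  common-bound : ∀ {s t} (2≤r : 2 ≤ suc m) → ¬ K (suc m) s t 2≤r ⊑ G →
    (us : Vec (Vec (Fin n) m) t) → Uniqueᵛ (Vec.concat us) → ∑ (allFin n) (λ y → ⟦ common? us y ⟧) ≤ s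
  common-bound {s} {t} 2≤r free us us! with ≤-total (length (filter (common? us) (allFin n))) s
  ... | inj₁ ≤s = ≤-trans (≤-reflexive (∑-⟦⟧ (common? us) (allFin n))) ≤s
  ... | inj₂ s≤ = ⊥-elim (free (Vec.lookup v , Uniqueᵛ.lookup-injective v! _ _ , All.tabulate embeds))
    where
    open CompleteBipartite (suc m) s t using (x; y; X; edge)

    L : List (Fin n)
    L = filter (common? us) (allFin n)

    z : Fin s → Fin n
    z b = lookup L (inject≤ b s≤)

    z-common : ∀ b → Common us (z b)
    z-common b = proj₂ (∈-filter⁻ (common? us) {xs = allFin n} (∈-lookup {xs = L} (inject≤ b s≤)))

    z-edge : ∀ i b → IsEdge (z b ∷ Vec.lookup us i)
    z-edge i b = Allᵛ.lookup⁺ (z-common b) i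

    z! : Uniqueᵛ (Vec.tabulate z)
    z! = Uniqueᵛ.tabulate⁺ λ eq → inject≤-injective s≤ s≤ _ _
      (lookup-injective (Unique.filter⁺ (common? us) (Unique.allFin⁺ n)) _ _ eq)

    -- Y avoids the blocks because each edge `z b ∷ u` has distinct letters.
    us∌z : ∀ i a b → Vec.lookup (Vec.lookup us i) a ≢ z b
    us∌z i a b eq with zb∉u ∷ _ ← proj₁ (z-edge i b) = Allᵛ.lookup⁺ zb∉u a (sym eq)

    -- The embedding written as a word: its positions follow the numbering of the vertices of `K`,
    -- block after block and then Y.
    v : Vec (Fin n) (t * m + s)
    v = Vec.concat us Vec.++ Vec.tabulate z

    v! : Uniqueᵛ v
    v! = AllPairsᵛ.++⁺ us! z! (Allᵛ.concat⁺ {xss = us}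
      (Allᵛ.lookup⁻ λ i → Allᵛ.lookup⁻ λ a → Allᵛ.tabulate⁺ λ b → us∌z i a b))

    lookup-x : ∀ i a → Vec.lookup v (x i a) ≡ Vec.lookup (Vec.lookup us i) a
    lookup-x i a = trans (Vec.lookup-++ˡ (Vec.concat us) _ (combine i a)) (Vec.lookup-concat {m = m} us i a)

    lookup-y : ∀ b → Vec.lookup v (y b) ≡ z b
    lookup-y b = trans (Vec.lookup-++ʳ (Vec.concat us) _ b) (Vec.lookup∘tabulate z b)

    image-edge : ∀ i b → image (Vec.lookup v) (edge i b) ≡ ⟪ z b ∷ Vec.lookup us i ⟫
    image-edge i b = Subset.⊆-antisym to from
      where
      w = z b ∷ Vec.lookup us i
      to : ∀ {j} → j ∈ˢ image (Vec.lookup v) (edge i b) → j ∈ˢ ⟪ w ⟫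
      to j∈ with c , c∈ , refl ← ∈-image⁻ (Vec.lookup v) (edge i b) j∈ with Subset.x∈p∪q⁻ (X i) _ c∈
      ... | inj₁ c∈X with a , _ , refl ← ∈-image⁻ (x i) ⊤ c∈X =
        subst (_∈ˢ ⟪ w ⟫) (sym (lookup-x i a)) (∈-image⁺ (Vec.lookup w) {i = suc a} Subset.∈⊤)
      ... | inj₂ c∈y with refl ← Subset.x∈⁅y⁆⇒x≡y _ c∈y =
        subst (_∈ˢ ⟪ w ⟫) (sym (lookup-y b)) (∈-image⁺ (Vec.lookup w) {i = zero} Subset.∈⊤)
      from : ∀ {j} → j ∈ˢ ⟪ w ⟫ → j ∈ˢ image (Vec.lookup v) (edge i b)
      from j∈ with ∈-⟪⟫⁻ w j∈
      ... | zero , refl = subst (_∈ˢ image (Vec.lookup v) (edge i b)) (lookup-y b)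
        (∈-image⁺ (Vec.lookup v) (Subset.x∈p∪q⁺ {p = X i} (inj₂ (Subset.x∈⁅x⁆ (y b)))))
      ... | suc a , refl = subst (_∈ˢ image (Vec.lookup v) (edge i b)) (lookup-x i a)
        (∈-image⁺ (Vec.lookup v) (Subset.x∈p∪q⁺ (inj₁ (∈-image⁺ (x i) {i = a} Subset.∈⊤))))

    embeds : ∀ {e} → e ∈ edges (K (suc m) s t 2≤r) → image (Vec.lookup v) e ∈ edges G
    embeds e∈ with i , b , _ , _ , refl ← ∈-cartesianProductWith⁻ edge (allFin t) (allFin s) e∈ =
      subst (_∈ edges G) (sym (image-edge i b)) (proj₂ (z-edge i b))

  -- Counting tuples of disjoint words in a graph with no copy of `K`.

  module Free {s} t (2≤r : 2 ≤ suc m) (free : ¬ K (suc m) s t 2≤r ⊑ G) where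

    -- The bound on words that meet the t * m letters of a full tuple. It covers every partial tuple
    -- as well, so one value serves the whole induction.
    meeting : ℕ
    meeting = m * (t * m) * n ^ (m ∸ 1)

    -- Truncated subtraction makes vertices of small degree contribute 0, which avoids a case
    -- distinction.
    excess : Fin n → ℕ
    excess y = degree y ∸ meeting

    excess≤extensions : ∀ (v : Vec (Fin n) l) → l ≤ t * m → Uniqueᵛ v → ∀ y →
      excess y ≤ ∑ (words n m) (extension y v)
    excess≤extensions v l≤ v! y = m≤n+o⇒m∸n≤o (degree y) meeting
      (≤-trans (degree≤extensions v v! y)
               (+-monoˡ-≤ _ (*-monoˡ-≤ (n ^ (m ∸ 1)) (*-monoʳ-≤ m l≤))))

    -- The summand bounds from below the number of completions of us to t disjoint words joined to y.
    ∑-common*excess : ∀ j (us : Vec (Vec (Fin n) m) k) → Uniqueᵛ (Vec.concat us) → k + j ≡ t →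
      ∑ (allFin n) (λ y → ⟦ common? us y ⟧ * excess y ^ j) ≤ (n ^ m) ^ j * s
    -- Here `us` is a full t-tuple and the power of `excess` is 1, so only the common neighbours are
    -- counted.
    ∑-common*excess {k} zero us us! k+0≡t with refl ← trans (sym (+-identityʳ k)) k+0≡t = begin
      ∑ (allFin n) (λ y → ⟦ common? us y ⟧ * 1) ≤⟨ ∑-mono (allFin n) (λ y → ≤-reflexive (*-identityʳ _)) ⟩
      ∑ (allFin n) (λ y → ⟦ common? us y ⟧)     ≤⟨ common-bound 2≤r free us us! ⟩
      s                                         ≡⟨ *-identityˡ s ⟨
      1 * s                                     ∎
      where open ≤-Reasoning
    ∑-common*excess {k} (suc j) us us! k+1+j≡t = begin
      ∑ (allFin n) (λ y → ⟦ common? us y ⟧ * excess y ^ suc j)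
        ≤⟨ ∑-mono (allFin n) pointwise ⟩
      ∑ (allFin n) (λ y → ∑ (words n m) (λ w → disj w * (⟦ common? (w ∷ us) y ⟧ * excess y ^ j)))
        ≡⟨ ∑-swap (allFin n) (words n m) _ ⟩
      ∑ (words n m) (λ w → ∑ (allFin n) (λ y → disj w * (⟦ common? (w ∷ us) y ⟧ * excess y ^ j)))
        ≤⟨ ∑-mono (words n m) perWord ⟩
      ∑ (words n m) (λ _ → (n ^ m) ^ j * s)
        ≡⟨ ∑-words-const n m _ ⟩
      n ^ m * ((n ^ m) ^ j * s)
        ≡⟨ *-assoc (n ^ m) _ s ⟨
      (n ^ m) ^ suc j * s ∎
      where
      open ≤-Reasoning
      disj : Vec (Fin n) m → ℕ
      disj w = ⟦ uniqueᵛ? (w Vec.++ Vec.concat us) ⟧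

      k≤t : k ≤ t
      k≤t = subst (k ≤_) k+1+j≡t (m≤m+n k (suc j))

      perWord : ∀ w → ∑ (allFin n) (λ y → disj w * (⟦ common? (w ∷ us) y ⟧ * excess y ^ j)) ≤ (n ^ m) ^ j * s
      perWord w = ≤-trans (≤-reflexive (sym (*-distribˡ-∑ (allFin n) (disj w) _))) bound
        where
        bound : disj w * ∑ (allFin n) (λ y → ⟦ common? (w ∷ us) y ⟧ * excess y ^ j) ≤ (n ^ m) ^ j * s
        -- A word that cannot be added to the tuple has weight 0; for any other the induction
        -- hypothesis applies to `w ∷ us`.
        bound with uniqueᵛ? (w Vec.++ Vec.concat us)
        ... | no  _  = z≤n
        ... | yes u! = ≤-trans (≤-reflexive (*-identityˡ _))
          (∑-common*excess j (w ∷ us) u! (trans (sym (+-suc k j)) k+1+j≡t))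

      shuffle : ∀ c d e q → c * (d * e * q) ≡ d * (e * c * q)
      shuffle = solve-∀

      -- One factor `excess y` is traded for a sum over words `w` that extend the tuple; if `y` is
      -- common to `us` and joined to `w`, it is common to `w ∷ us`.
      pointwise : ∀ y → ⟦ common? us y ⟧ * (excess y * excess y ^ j) ≤
        ∑ (words n m) (λ w → disj w * (⟦ common? (w ∷ us) y ⟧ * excess y ^ j))
      pointwise y = begin
        c * (excess y * excess y ^ j)
          ≤⟨ *-monoʳ-≤ c (*-monoˡ-≤ (excess y ^ j)
               (excess≤extensions (Vec.concat us) (*-monoˡ-≤ m k≤t) us! y)) ⟩
        c * (∑ (words n m) (extension y (Vec.concat us)) * excess y ^ j)
          ≡⟨ cong (c *_) (*-distribʳ-∑ (words n m) (excess y ^ j) _) ⟩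
        c * ∑ (words n m) (λ w → extension y (Vec.concat us) w * excess y ^ j)
          ≡⟨ *-distribˡ-∑ (words n m) c _ ⟩
        ∑ (words n m) (λ w → c * (extension y (Vec.concat us) w * excess y ^ j))
          ≤⟨ ∑-mono (words n m) (λ w → ≤-trans
               (≤-reflexive (shuffle c (disj w) ⟦ isEdge? (y ∷ w) ⟧ (excess y ^ j)))
               (*-monoʳ-≤ (disj w) (*-monoˡ-≤ (excess y ^ j)
                 (⟦⟧-× (isEdge? (y ∷ w)) (common? us y) (common? (w ∷ us) y) _∷_)))) ⟩
        ∑ (words n m) (λ w → disj w * (⟦ common? (w ∷ us) y ⟧ * excess y ^ j)) ∎
        where
        c = ⟦ common? us y ⟧

    -- The induction started from the empty tuple, to which every vertex is vacuously common.
    ∑-excess^t : ∑ (allFin n) (λ y → excess y ^ t) ≤ (n ^ m) ^ t * s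
    ∑-excess^t = ≤-trans (∑-mono (allFin n) (λ y → ≤-reflexive (sym (*-identityˡ (excess y ^ t)))))
                         (∑-common*excess t [] [] refl)

    size≤ : size G ≤ n * meeting + ∑ (allFin n) excess
    size≤ = begin
      size G                                             ≤⟨ size≤∑degree ⟩
      ∑ (allFin n) degree                                ≤⟨ ∑-mono (allFin n) (λ y → m≤n+m∸n (degree y) meeting) ⟩
      ∑ (allFin n) (λ y → meeting + excess y)            ≡⟨ ∑-+ (allFin n) _ _ ⟩
      ∑ (allFin n) (λ _ → meeting) + ∑ (allFin n) excess ≡⟨ cong (_+ ∑ (allFin n) excess) (∑-allFin-const n meeting) ⟩
      n * meeting + ∑ (allFin n) excess                  ∎
      where open ≤-Reasoning

-- Exponents, constants and the final bound.

-- The product `suc m * suc k` computes to a successor, so the truncated subtraction loses nothing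
-- and the last equality is definitional.
n^[1+k]*[n^m]^[1+k] : ∀ n m k → n ^ suc k * (n ^ m) ^ suc k ≡ n * n ^ (suc m * suc k ∸ 1)
n^[1+k]*[n^m]^[1+k] n m k = begin
  n ^ suc k * (n ^ m) ^ suc k ≡⟨ ^-distribʳ-* n (n ^ m) (suc k) ⟨
  (n ^ suc m) ^ suc k         ≡⟨ ^-*-assoc n (suc m) (suc k) ⟩
  n ^ (suc m * suc k)         ∎
  where open ≡-Reasoning

-- In `size≤` the first summand is c n^m, and the second is controlled by `∑-excess^t` through
-- `power-mean`. In the constant, c^t comes from the first, 2^t * s from the second, and the leading
-- 2 from splitting the power of a sum.
free⇒size^t≤ : ∀ {m n s} k .{{_ : NonZero n}} (2≤r : 2 ≤ suc m) (G : RGraph (suc m) n) →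
  ¬ K (suc m) s (suc k) 2≤r ⊑ G → let t = suc k; c = m * (t * m) in
  size G ^ t ≤ (2 * (c ^ t + 2 ^ t * s)) ^ t * n ^ (suc m * t ∸ 1)
free⇒size^t≤ {m} {n} {s} k 2≤r G free = begin
  size G ^ t                           ≤⟨ ^-monoˡ-≤ t (size≤) ⟩
  (n * M + S) ^ t                      ≤⟨ [a+b]^k≤2^k*[a^k+b^k] (n * M) S t ⟩
  2 ^ t * ((n * M) ^ t + S ^ t)        ≤⟨ *-monoʳ-≤ (2 ^ t) (+-mono-≤ meeting^t excess^t) ⟩
  2 ^ t * (c ^ t * n ^ q + 2 ^ t * s * n ^ q) ≡⟨ cong (2 ^ t *_) (*-distribʳ-+ (n ^ q) (c ^ t) (2 ^ t * s)) ⟨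
  -- Raising D to D^t makes the whole constant a t-th power.
  2 ^ t * (D * n ^ q)                  ≤⟨ *-monoʳ-≤ (2 ^ t) (*-monoˡ-≤ (n ^ q) (m≤m^[1+k] D k)) ⟩
  2 ^ t * (D ^ t * n ^ q)              ≡⟨ *-assoc (2 ^ t) (D ^ t) (n ^ q) ⟨
  2 ^ t * D ^ t * n ^ q                ≡⟨ cong (_* n ^ q) (^-distribʳ-* 2 D t) ⟨
  (2 * D) ^ t * n ^ q                  ∎
  where
  open ≤-Reasoning
  open Links G
  open Free (suc k) 2≤r free
  t q c D M S : ℕ
  t = suc k
  q = suc m * t ∸ 1
  c = m * (t * m)
  D = c ^ t + 2 ^ t * s
  M = meeting
  S = ∑ (allFin n) (excess)

  pull : ∀ n c q → n * (c * q) ≡ c * (n * q)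
  pull = solve-∀

  n*c*n^[m∸1] : ∀ m → n * (m * (t * m) * n ^ (m ∸ 1)) ≡ m * (t * m) * n ^ m
  n*c*n^[m∸1] zero    = *-zeroʳ n
  n*c*n^[m∸1] (suc m) = pull n (suc m * (t * suc m)) (n ^ m)

  meeting^t : (n * M) ^ t ≤ c ^ t * n ^ q
  meeting^t = begin
    (n * M) ^ t           ≡⟨ cong (_^ t) (n*c*n^[m∸1] m) ⟩
    (c * n ^ m) ^ t       ≡⟨ ^-distribʳ-* c (n ^ m) t ⟩
    c ^ t * (n ^ m) ^ t   ≡⟨ cong (c ^ t *_) (^-*-assoc n m t) ⟩
    -- The exponent q computes to k + m * t, so this term is of no higher order than the main one.
    c ^ t * n ^ (m * t)   ≤⟨ *-monoʳ-≤ (c ^ t) (^-monoʳ-≤ n (m≤n+m (m * t) k)) ⟩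
    c ^ t * n ^ q         ∎

  assemble : ∀ a b d s → a * b * (d * s) ≡ a * s * (b * d)
  assemble = solve-∀

  excess^t : S ^ t ≤ 2 ^ t * s * n ^ q
  -- The factor n that `power-mean` leaves on the left is cancelled; this lowers the exponent from r
  -- t to r t - 1 and needs n to be positive.
  excess^t = *-cancelˡ-≤ n (begin
    n * S ^ t
      ≡⟨ cong (_* S ^ t) (length-tabulate {n = n} _) ⟨
    length (allFin n) * S ^ t
      ≤⟨ power-mean (allFin n) (excess) k ⟩
    (2 * length (allFin n)) ^ t * ∑ (allFin n) (λ y → excess y ^ t)
      ≤⟨ *-monoʳ-≤ ((2 * length (allFin n)) ^ t) (∑-excess^t) ⟩
    (2 * length (allFin n)) ^ t * ((n ^ m) ^ t * s)
      ≡⟨ cong (λ l → (2 * l) ^ t * ((n ^ m) ^ t * s)) (length-tabulate {n = n} _) ⟩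
    (2 * n) ^ t * ((n ^ m) ^ t * s)
      ≡⟨ cong (_* ((n ^ m) ^ t * s)) (^-distribʳ-* 2 n t) ⟩
    2 ^ t * n ^ t * ((n ^ m) ^ t * s)
      ≡⟨ assemble (2 ^ t) (n ^ t) ((n ^ m) ^ t) s ⟩
    2 ^ t * s * (n ^ t * (n ^ m) ^ t)
      ≡⟨ cong (2 ^ t * s *_) (n^[1+k]*[n^m]^[1+k] n m k) ⟩
    2 ^ t * s * (n * n ^ q)
      ≡⟨ pull n (2 ^ t * s) (n ^ q) ⟨
    n * (2 ^ t * s * n ^ q) ∎)

theorem1p3 : ∀ (r s t : ℕ) (3≤r : 3 ≤ r) → t ≤ s → 2 ≤ t →
    ex (K r s t (<⇒≤ 3≤r)) =O[n^ (r * t ∸ 1) / t ]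
-- The threshold 1 makes n positive for the cancellation. With s and t successors the edge list of
-- `K` reduces to a cons, so `ex` is attained by a graph with no copy of `K`.
theorem1p3 (suc m) s@(suc _) t@(suc k) 3≤r _ _ = 2 * ((m * (t * m)) ^ t + 2 ^ t * s) , 1 , λ n 1≤n →
  let H = K (suc m) s t (<⇒≤ 3≤r)
      G , free , size≡ex = IsTuránNumber.attained (ex-isMaximum H (λ ()) n)
  in subst (λ e → e ^ t ≤ (2 * ((m * (t * m)) ^ t + 2 ^ t * s)) ^ t * n ^ (suc m * t ∸ 1)) size≡ex (free⇒size^t≤ k {{>-nonZero 1≤n}} (<⇒≤ 3≤r) G free)
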